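{- Let $G=(V,E)$ be a partial cube obtained by vertex-pasting together partial cubes $G_1=(V_1,E_1)$ and $G_2=(V_2,E_2)$. Then $$\dim_I(G)=\dim_I(G_1)+\dim_I(G_2).$$
   Context: Graphs are simple, undirected, nonempty, and not necessarily finite. For a set $X$, the hypercube $\mathcal H(X)$ is the graph whose vertices are the finite subsets of $X$, with $P,Q$ adjacent iff $|P\Delta Q|=1$; its dimension is the cardinality $|X|$. A graph is a partial cube if it can be isometrically embedded (i.e. by a map preserving shortest-path distances) into some $\mathcal H(X)$. The isometric dimension $\dim_I(G)$ of a partial cube $G$ is the minimum possible dimension (a cardinal) of a hypercube $\mathcal H(X)$ into which $G$ is isometrically embeddable. Vertex-pasting: given connected graphs $G_1,G_2$ and vertices $a_1\in V_1$, $a_2\in V_2$, the graph obtained by vertex-pasting is the graph obtained from the disjoint union of $G_1$ and $G_2$ by identifying $a_1$ with $a_2$ (and making no other identifications). -}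

module Defs where

open import Level using (Level; suc)
open import Data.List.Base using (List; [])
import Data.List.Membership.Setoid as Membership
open import Data.Nat.Base using (ℕ; zero; _≤_) renaming (suc to 1+)
open import Data.Product using (∃; ∃!; _×_; _,_)
open import Data.Sum.Base using (_⊎_; inj₁; inj₂; swap)
open import Data.Sum.Relation.Binary.Pointwise using (Pointwise; inj₁; inj₂)
import Data.Sum.Relation.Binary.Pointwise as Pointwise
open import Function.Bundles using (Func; Injection; Bijection; _⇔_; Equivalence)
import Function.Properties.Equivalence as ⇔
open import Relation.Binary.Bundles using (Setoid)
open import Relation.Binary.Core using (Rel)
open import Relation.Binary.Definitions
  using (Reflexive; Symmetric; Transitive; Irreflexive; _Respects₂_)
open import Relation.Nullary using (¬_)

private
  variable
    ℓ : Level

-- Sets are setoids throughout; a cardinal is given by any setoid having that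
-- cardinality.

infix 4 _≼_ _≃_

_≼_ : Setoid ℓ ℓ → Setoid ℓ ℓ → Set ℓ
X ≼ Y = Injection X Y

_≃_ : Setoid ℓ ℓ → Setoid ℓ ℓ → Set ℓ
X ≃ Y = Bijection X Y

record Graph (ℓ : Level) : Set (suc ℓ) where
  infix 4 _~_
  field
    vertices : Setoid ℓ ℓ

  open Setoid vertices public using (_≈_) renaming (Carrier to Vertex)

  field
    _~_        : Rel Vertex ℓ
    ~-resp-≈   : _~_ Respects₂ _≈_
    ~-sym      : Symmetric _~_
    ~-irrefl   : Irreflexive _≈_ _~_
    nonempty   : Vertex

module _ (G : Graph ℓ) where
  open Graph G

  data Walk : Vertex → Vertex → ℕ → Set ℓ where
    stop : ∀ {u v} → u ≈ v → Walk u v zero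
    step : ∀ {u v w n} → u ~ v → Walk v w n → Walk u w (1+ n)

  -- "The distance from u to v is n"; it holds for no n when u and v lie in
  -- different components.
  Distance : Vertex → Vertex → ℕ → Set ℓ
  Distance u v n = Walk u v n × (∀ m → Walk u v m → n ≤ m)

record IsometricEmbedding (G H : Graph ℓ) : Set ℓ where
  private
    module G = Graph G
    module H = Graph H
  field
    map : Func G.vertices H.vertices

  open Func map public using (to)

  field
    isometric : ∀ u v n → Distance G u v n ⇔ Distance H (to u) (to v) n

module _ (X : Setoid ℓ ℓ) where
  open Setoid X using (_≈_) renaming (Carrier to A)
  open Membership X using (_∈_)

  -- A list stands for the finite set of its entries; order and repetitions
  -- are discarded by the equality.
  FiniteSubset : Setoid ℓ ℓ
  FiniteSubset = record
    { Carrier       = List A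
    ; _≈_           = λ P Q → ∀ x → x ∈ P ⇔ x ∈ Q
    ; isEquivalence = record
      { refl  = λ x → ⇔.refl
      ; sym   = λ P≈Q x → ⇔.sym (P≈Q x)
      ; trans = λ P≈Q Q≈R x → ⇔.trans (P≈Q x) (Q≈R x)
      }
    }

  private
    module S = Setoid FiniteSubset

  _∈[_Δ_] : A → List A → List A → Set ℓ
  x ∈[ P Δ Q ] = (x ∈ P × ¬ x ∈ Q) ⊎ (x ∈ Q × ¬ x ∈ P)

  -- |P Δ Q| = 1
  Adjacent : Rel (List A) ℓ
  Adjacent P Q = ∃! _≈_ (λ x → x ∈[ P Δ Q ])

  private
    Δ-resp : ∀ {P P′ Q Q′ x} → P S.≈ P′ → Q S.≈ Q′ →
             x ∈[ P Δ Q ] → x ∈[ P′ Δ Q′ ]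
    Δ-resp p q (inj₁ (x∈P , x∉Q)) =
      inj₁ (Equivalence.to (p _) x∈P , λ x∈Q′ → x∉Q (Equivalence.from (q _) x∈Q′))
    Δ-resp p q (inj₂ (x∈Q , x∉P)) =
      inj₂ (Equivalence.to (q _) x∈Q , λ x∈P′ → x∉P (Equivalence.from (p _) x∈P′))

    Adjacent-resp : ∀ {P P′ Q Q′} → P S.≈ P′ → Q S.≈ Q′ →
                    Adjacent P Q → Adjacent P′ Q′
    Adjacent-resp {P} {P′} {Q} {Q′} p q (x , x∈ , unique) =
      x , Δ-resp {P} {P′} {Q} {Q′} p q x∈ ,
      λ y∈ → unique (Δ-resp {P′} {P} {Q′} {Q} (S.sym {P} {P′} p) (S.sym {Q} {Q′} q) y∈)

    Adjacent-irrefl : ∀ {P Q} → P S.≈ Q → ¬ Adjacent P Q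
    Adjacent-irrefl p (x , inj₁ (x∈P , x∉Q) , _) = x∉Q (Equivalence.to (p x) x∈P)
    Adjacent-irrefl p (x , inj₂ (x∈Q , x∉P) , _) = x∉P (Equivalence.from (p x) x∈Q)

  Hypercube : Graph ℓ
  Hypercube = record
    { vertices = FiniteSubset
    ; _~_      = Adjacent
    ; ~-resp-≈ =
        (λ {P} {Q} {Q′} q → Adjacent-resp {P} {P} {Q} {Q′} (S.refl {P}) q) ,
        (λ {Q} {P} {P′} p → Adjacent-resp {P} {P′} {Q} {Q} p (S.refl {Q}))
    ; ~-sym    = λ (x , x∈ , unique) → x , swap x∈ , λ y∈ → unique (swap y∈)
    ; ~-irrefl = λ {P} {Q} → Adjacent-irrefl {P} {Q}
    ; nonempty = []
    }

IsPartialCube : Graph ℓ → Set (suc ℓ)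
IsPartialCube {ℓ} G = ∃ λ (X : Setoid ℓ ℓ) → IsometricEmbedding G (Hypercube X)

-- A setoid representing the least cardinal |X| such that G embeds
-- isometrically into Hypercube X.
record IsometricDimension (G : Graph ℓ) : Set (suc ℓ) where
  field
    cardinal  : Setoid ℓ ℓ
    attained  : IsometricEmbedding G (Hypercube cardinal)
    minimum   : ∀ (Y : Setoid ℓ ℓ) → IsometricEmbedding G (Hypercube Y) → cardinal ≼ Y

open IsometricDimension public using (cardinal)

module _ (G₁ G₂ : Graph ℓ) (a₁ : Graph.Vertex G₁) (a₂ : Graph.Vertex G₂) where
  private
    module G₁ = Graph G₁
    module G₂ = Graph G₂
    module V₁ = Setoid G₁.vertices
    module V₂ = Setoid G₂.vertices

    V : Set ℓ
    V = G₁.Vertex ⊎ G₂.Vertex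

  data Identified : Rel V ℓ where
    same₁  : ∀ {x y} → x G₁.≈ y → Identified (inj₁ x) (inj₁ y)
    same₂  : ∀ {x y} → x G₂.≈ y → Identified (inj₂ x) (inj₂ y)
    glue₁₂ : ∀ {x y} → x G₁.≈ a₁ → y G₂.≈ a₂ → Identified (inj₁ x) (inj₂ y)
    glue₂₁ : ∀ {x y} → x G₂.≈ a₂ → y G₁.≈ a₁ → Identified (inj₂ x) (inj₁ y)

  private
    ≈-refl : Reflexive Identified
    ≈-refl {inj₁ x} = same₁ V₁.refl
    ≈-refl {inj₂ x} = same₂ V₂.refl

    ≈-sym : Symmetric Identified
    ≈-sym (same₁ p)    = same₁ (V₁.sym p)
    ≈-sym (same₂ p)    = same₂ (V₂.sym p)
    ≈-sym (glue₁₂ p q) = glue₂₁ q p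
    ≈-sym (glue₂₁ p q) = glue₁₂ q p

    ≈-trans : Transitive Identified
    ≈-trans (same₁ p)    (same₁ q)    = same₁ (V₁.trans p q)
    ≈-trans (same₁ p)    (glue₁₂ q r) = glue₁₂ (V₁.trans p q) r
    ≈-trans (same₂ p)    (same₂ q)    = same₂ (V₂.trans p q)
    ≈-trans (same₂ p)    (glue₂₁ q r) = glue₂₁ (V₂.trans p q) r
    ≈-trans (glue₁₂ p q) (same₂ r)    = glue₁₂ p (V₂.trans (V₂.sym r) q)
    ≈-trans (glue₁₂ p q) (glue₂₁ r s) = same₁ (V₁.trans p (V₁.sym s))
    ≈-trans (glue₂₁ p q) (same₁ r)    = glue₂₁ p (V₁.trans (V₁.sym r) q)
    ≈-trans (glue₂₁ p q) (glue₁₂ r s) = same₂ (V₂.trans p (V₂.sym s))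

  -- The edges of the disjoint union, transported to the quotient by
  -- Identified.
  PastedEdge : Rel V ℓ
  PastedEdge u v = ∃ λ u′ → ∃ λ v′ →
    Identified u u′ × Identified v v′ × Pointwise G₁._~_ G₂._~_ u′ v′

  private
    edge-irrefl : ∀ {u v} → Identified u v → ¬ Pointwise G₁._~_ G₂._~_ u v
    edge-irrefl (same₁ p) (inj₁ e) = G₁.~-irrefl p e
    edge-irrefl (same₂ p) (inj₂ e) = G₂.~-irrefl p e

  VertexPasting : Graph ℓ
  VertexPasting = record
    { vertices = record
      { Carrier       = V
      ; _≈_           = Identified
      ; isEquivalence = record { refl = ≈-refl ; sym = ≈-sym ; trans = ≈-trans }
      }
    ; _~_      = PastedEdge
    ; ~-resp-≈ =
        (λ q (u′ , v′ , u≈ , v≈ , e) → u′ , v′ , u≈ , ≈-trans (≈-sym q) v≈ , e) ,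
        (λ q (u′ , v′ , u≈ , v≈ , e) → u′ , v′ , ≈-trans (≈-sym q) u≈ , v≈ , e)
    ; ~-sym    = λ (u′ , v′ , u≈ , v≈ , e) →
        v′ , u′ , v≈ , u≈ , Pointwise.⊎-symmetric G₁.~-sym G₂.~-sym e
    ; ~-irrefl = λ u≈v (u′ , v′ , u≈ , v≈ , e) →
        edge-irrefl (≈-trans (≈-sym u≈) (≈-trans u≈v v≈)) e
    ; nonempty = inj₁ G₁.nonempty
    }

{-# OPTIONS --safe #-}

-- In an isometric embedding of a partial cube into a hypercube every edge flips
-- one coordinate, its label. Which edges share a label is determined by
-- distances alone, so the set of labels has the same cardinality for every
-- embedding; as coordinates that label no edge can be dropped, this cardinality
-- is the isometric dimension. Embeddings of G₁ and G₂ in cubes on X₁ and X₂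
-- combine to one of their pasting in the cube on X₁ ⊎ X₂, which gives ≤. There
-- no edge of G₁ shares a label with an edge of G₂, hence neither in any other
-- embedding of the pasting; since G₁ and G₂ are isometric in the pasting,
-- restricting a minimal embedding to them gives ≥. Cantor–Schröder–Bernstein
-- concludes.
module Submission where

open import Defs
open import Level using (Level)
open import Axiom.ExcludedMiddle using (ExcludedMiddle)
open import Data.Bool.Base using (Bool)
open import Data.Bool.Properties using (¬-not) renaming (_≟_ to _≟ᵇ_)
open import Data.List.Base using (List; []; _∷_; _++_; map; filter)
import Data.List.Membership.Setoid as Membership
import Data.List.Membership.Setoid.Properties as ∈
open import Data.List.Relation.Unary.Any using (here; there)
open import Data.Nat.Base using (zero; suc; _+_; _≤_; _<_; z≤n; s≤s)
open import Data.Nat.Properties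
  using (≤-refl; <⇒≤; ≤-reflexive; ≤-trans; ≤-antisym; <-≤-trans; m≤n⇒m≤1+n; +-mono-≤; _≤?_;
         m≤m+n; m≤n+m; ≰⇒>; +-comm; +-suc)
open import Data.Product using (Σ; ∃-syntax; _×_; _,_; proj₁; proj₂)
open import Data.Sum.Base using (_⊎_; inj₁; inj₂; [_,_]′)
open import Data.Sum.Function.Setoid using (_⊎-injection_)
open import Data.Sum.Relation.Binary.Pointwise
  using (Pointwise; inj₁; inj₂; _⊎ₛ_; drop-inj₁; drop-inj₂)
open import Function.Base using (_∘_)
open import Function.Bundles using (Func; Injection; Equivalence; _⇔_; mk⇔)
import Function.Construct.Composition as Compose
open import Relation.Binary.Bundles using (Setoid)
open import Relation.Binary.PropositionalEquality using (_≡_; _≢_; refl; sym; trans; cong)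
open import Relation.Nullary using (¬_; Dec; yes; no; does; contradiction)
open import Relation.Nullary.Decidable using (does-⇔; ¬?)

private
  variable
    ℓ : Level

  ≢-≢⇒≡ : {x y z : Bool} → x ≢ y → y ≢ z → x ≡ z
  ≢-≢⇒≡ x≢y y≢z = trans (¬-not x≢y) (sym (¬-not (λ z≡y → y≢z (sym z≡y))))

-- Walks and distances in a graph.

module Walks (G : Graph ℓ) where
  open Graph G using (_≈_; _~_; ~-resp-≈; ~-irrefl)
  open Setoid (Graph.vertices G) using () renaming (refl to ≈-refl; sym to ≈-sym; trans to ≈-trans)

  walk-respˡ : ∀ {u u′ v n} → u ≈ u′ → Walk G u v n → Walk G u′ v n
  walk-respˡ p (stop q)   = stop (≈-trans (≈-sym p) q)
  walk-respˡ p (step e w) = step (proj₂ ~-resp-≈ p e) w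

  walk-respʳ : ∀ {u v v′ n} → v ≈ v′ → Walk G u v n → Walk G u v′ n
  walk-respʳ p (stop q)   = stop (≈-trans q p)
  walk-respʳ p (step e w) = step e (walk-respʳ p w)

  concat : ∀ {u v w m n} → Walk G u v m → Walk G v w n → Walk G u w (m + n)
  concat (stop p)   w′ = walk-respˡ (≈-sym p) w′
  concat (step e w) w′ = step e (concat w w′)

  edge⇒distance : ∀ {u v} → u ~ v → Distance G u v 1
  edge⇒distance {u} {v} e = step e (stop ≈-refl) , bound
    where
    bound : ∀ m → Walk G u v m → 1 ≤ m
    bound zero    (stop p) = contradiction e (~-irrefl p)
    bound (suc m) _        = s≤s z≤n

  distance⇒edge : ∀ {u v} → Distance G u v 1 → u ~ v
  distance⇒edge (step e (stop p) , _) = proj₁ ~-resp-≈ p e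

-- Maps of walks and a criterion for isometry.

module _ (G H : Graph ℓ) where
  private
    module G = Graph G
    module H = Graph H
    module V = Setoid H.vertices

  module _ (f : Func G.vertices H.vertices) where
    open Func f using (to) renaming (cong to to-cong)

    -- Edges collapsed to a vertex are dropped, hence a bound instead of the exact length. The
    -- retractions of a pasting onto its two parts act on walks in this way.
    walk-contract : (∀ {u v} → u G.~ v → to u H.~ to v ⊎ to u H.≈ to v) →
                    ∀ {u v n} → Walk G u v n → ∃[ m ] m ≤ n × Walk H (to u) (to v) m
    walk-contract edge (stop p) = 0 , z≤n , stop (to-cong p)
    walk-contract edge (step e w) with edge e | walk-contract edge w
    ... | inj₁ e′ | m , m≤n , w′ = suc m , s≤s m≤n , step e′ w′
    ... | inj₂ p  | m , m≤n , w′ =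
      m , m≤n⇒m≤1+n m≤n , Walks.walk-respˡ H (V.sym p) w′

    walk-map : (∀ {u v} → u G.~ v → to u H.~ to v) →
               ∀ {u v n} → Walk G u v n → Walk H (to u) (to v) n
    walk-map edge (stop p)   = stop (to-cong p)
    walk-map edge (step e w) = step (edge e) (walk-map edge w)

    -- Reflecting walks up to shortening suffices. A shortest walk of `H` comes from a walk of `G`
    -- that is no longer, whose image in turn cannot be shorter than the shortest one, so both
    -- lengths agree.
    isometricEmbedding :
      (∀ {u v} → u G.~ v → to u H.~ to v) →
      (∀ {u v n} → Walk H (to u) (to v) n → ∃[ m ] m ≤ n × Walk G u v m) →
      IsometricEmbedding G H
    isometricEmbedding edge reflect = record
      { map       = f
      ; isometric = λ u v n → mk⇔ preserves reflects
      }
      where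
      preserves : ∀ {u v n} → Distance G u v n → Distance H (to u) (to v) n
      preserves (w , n≤) = walk-map edge w , λ m w′ →
        let m′ , m′≤m , w″ = reflect w′ in ≤-trans (n≤ m′ w″) m′≤m

      reflects : ∀ {u v n} → Distance H (to u) (to v) n → Distance G u v n
      reflects {u} {v} {n} (w , n≤) with reflect w
      ... | m , m≤n , w′ with ≤-antisym m≤n (n≤ m (walk-map edge w′))
      ... | refl = w′ , λ m′ w″ → n≤ m′ (walk-map edge w″)

composeIsometric : {G H K : Graph ℓ} →
  IsometricEmbedding G H → IsometricEmbedding H K → IsometricEmbedding G K
composeIsometric {G = G} {H} {K} f g = record
  { map       = Compose.function f.map g.map
  ; isometric = λ u v n → mk⇔
      (λ d → Equivalence.to (g.isometric _ _ n) (Equivalence.to (f.isometric u v n) d))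
      (λ d → Equivalence.from (f.isometric u v n) (Equivalence.from (g.isometric _ _ n) d))
  }
  where
  module f = IsometricEmbedding f
  module g = IsometricEmbedding g

module Classical (em : ExcludedMiddle ℓ) where

  -- The Cantor-Schröder-Bernstein theorem for setoids.

  module _ {X Y : Setoid ℓ ℓ} (X≼Y : X ≼ Y) (Y≼X : Y ≼ X) where
    private
      module X = Setoid X
      module Y = Setoid Y
      module f = Injection X≼Y
      module g = Injection Y≼X

    -- Tracing such an x back alternately through g and f ends outside the image
    -- of g. The Cantor–Schröder–Bernstein bijection is f on these x and the
    -- inverse of g on the others.
    data FromOutside : X.Carrier → Set ℓ where
      outside : ∀ {x} → ¬ (∃[ y ] g.to y X.≈ x) → FromOutside x
      next    : ∀ {x x′} → FromOutside x → g.to (f.to x) X.≈ x′ → FromOutside x′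

    private
      resp : ∀ {x x′} → x X.≈ x′ → FromOutside x → FromOutside x′
      resp p (outside ∉) = outside λ (y , q) → ∉ (y , X.trans q (X.sym p))
      resp p (next r q)  = next r (X.trans q p)

      -- The bijection as a relation, so that its properties can be proved without unfolding the
      -- case distinctions in `total`.
      _↦_ : X.Carrier → Y.Carrier → Set ℓ
      x ↦ y = (FromOutside x × f.to x Y.≈ y) ⊎ (¬ FromOutside x × g.to y X.≈ x)

      total : ∀ x → ∃[ y ] x ↦ y
      total x with em {P = FromOutside x} | em {P = ∃[ y ] g.to y X.≈ x}
      ... | yes r | _           = f.to x , inj₁ (r , Y.refl)
      ... | no ¬r | yes (y , p) = y , inj₂ (¬r , p)
      ... | no ¬r | no ∉        = contradiction (outside ∉) ¬r

      functional : ∀ {x x′ y y′} → x X.≈ x′ → x ↦ y → x′ ↦ y′ → y Y.≈ y′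
      functional p (inj₁ (r , q)) (inj₁ (r′ , q′)) = Y.trans (Y.sym q) (Y.trans (f.cong p) q′)
      functional p (inj₁ (r , q)) (inj₂ (r′ , q′)) = contradiction (resp p r) r′
      functional p (inj₂ (r , q)) (inj₁ (r′ , q′)) = contradiction (resp (X.sym p) r′) r
      functional p (inj₂ (r , q)) (inj₂ (r′ , q′)) =
        g.injective (X.trans q (X.trans p (X.sym q′)))

      cofunctional : ∀ {x x′ y y′} → y Y.≈ y′ → x ↦ y → x′ ↦ y′ → x X.≈ x′
      cofunctional p (inj₁ (r , q)) (inj₁ (r′ , q′)) =
        f.injective (Y.trans q (Y.trans p (Y.sym q′)))
      -- Here `x′` is `g` of `f x`, so it would trace back outside together with `x`.
      cofunctional p (inj₁ (r , q)) (inj₂ (r′ , q′)) =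
        contradiction (next r (X.trans (g.cong (Y.trans q p)) q′)) r′
      cofunctional p (inj₂ (r , q)) (inj₁ (r′ , q′)) =
        contradiction (next r′ (X.trans (g.cong (Y.trans q′ (Y.sym p))) q)) r
      cofunctional p (inj₂ (r , q)) (inj₂ (r′ , q′)) =
        X.trans (X.sym q) (X.trans (g.cong p) q′)

      onto : ∀ y → ∃[ x ] x ↦ y
      onto y with em {P = FromOutside (g.to y)}
      ... | no ¬r               = g.to y , inj₂ (¬r , X.refl)
      ... | yes (outside ∉)     = contradiction (y , X.refl) ∉
      -- Tracing `g y` back through `g` must give `y`, so `y` is `f x`.
      ... | yes (next {x} r p)  = x , inj₁ (r , g.injective p)

    ≼-antisym : X ≃ Y
    ≼-antisym = record
      { to        = λ x → proj₁ (total x)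
      ; cong      = λ p → functional p (proj₂ (total _)) (proj₂ (total _))
      ; bijective =
          (λ p → cofunctional p (proj₂ (total _)) (proj₂ (total _))) ,
          λ y → proj₁ (onto y) , λ p → functional p (proj₂ (total _)) (proj₂ (onto y))
      }

  -- Shortest walks, and walks under isometric embeddings.

  module _ (G : Graph ℓ) where

    -- Excluded middle decides whether a shorter walk exists; while one does, pass to it. The bound
    -- `k` on the length makes this descent structural.
    shortest : ∀ {u v} n → Walk G u v n → ∃[ m ] m ≤ n × Distance G u v m
    shortest {u} {v} n w = search n ≤-refl w
      where
      search : ∀ k {m} → m ≤ k → Walk G u v m → ∃[ d ] d ≤ m × Distance G u v d
      search k {m} m≤k w with em {P = ∃[ j ] j < m × Walk G u v j}
      ... | no minimal = m , ≤-refl , w , λ j w′ → bound j w′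
        where
        bound : ∀ j → Walk G u v j → m ≤ j
        bound j w′ with m ≤? j
        ... | yes m≤j = m≤j
        ... | no  m≰j = contradiction (j , ≰⇒> m≰j , w′) minimal
      search (suc k) (s≤s m≤k) w | yes (j , s≤s j≤ , w′) =
        let d , d≤j , D = search k (≤-trans j≤ m≤k) w′
        in d , m≤n⇒m≤1+n (≤-trans d≤j j≤) , D

  module Isometric {G H : Graph ℓ} (φ : IsometricEmbedding G H) where
    private
      module G = Graph G
      module H = Graph H
    open IsometricEmbedding φ public using (to; isometric) renaming (map to func)
    open Func func public using () renaming (cong to to-cong)

    edge : ∀ {u v} → u G.~ v → to u H.~ to v
    edge {u} {v} e =
      Walks.distance⇒edge H (Equivalence.to (isometric u v 1) (Walks.edge⇒distance G e))

    preserve : ∀ {u v n} → Walk G u v n → Walk H (to u) (to v) n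
    preserve = walk-map G H func edge

    -- An isometric embedding reflects distances only, so the walk is first replaced by a shortest
    -- one with the same ends.
    reflect : ∀ {u v n} → Walk H (to u) (to v) n → ∃[ m ] m ≤ n × Walk G u v m
    reflect {u} {v} {n} w =
      let m , m≤n , D = shortest H n w
      in m , m≤n , proj₁ (Equivalence.from (isometric u v m) D)

  -- Coordinates, flips and walks in a hypercube.

  module Cube (X : Setoid ℓ ℓ) where
    open Setoid X public using (_≈_)
      renaming (Carrier to A; refl to ≈-refl; sym to ≈-sym; trans to ≈-trans)
    open Membership X public using (_∈_)
    module Sub = Setoid (FiniteSubset X)

    H : Graph ℓ
    H = Hypercube X

    -- Values in `Bool` let two successive changes of a coordinate cancel, and turn set equality
    -- into equational reasoning.
    χ : List A → A → Bool
    χ P z = does (em {P = z ∈ P})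

    χ-congˡ : ∀ {P Q} → P Sub.≈ Q → ∀ z → χ P z ≡ χ Q z
    χ-congˡ P≈Q z = does-⇔ (P≈Q z) em em

    χ-congʳ : ∀ P {y z} → y ≈ z → χ P y ≡ χ P z
    χ-congʳ P p = does-⇔ (mk⇔ (∈.∈-resp-≈ X p) (∈.∈-resp-≈ X (≈-sym p))) em em

    χ≡⇒∈ : ∀ {P Q z} → χ P z ≡ χ Q z → z ∈ P → z ∈ Q
    χ≡⇒∈ {P} {Q} {z} eq z∈P with em {P = z ∈ P} | em {P = z ∈ Q}
    ... | _      | yes z∈Q = z∈Q
    ... | no z∉P | no _    = contradiction z∈P z∉P

    χ-ext : ∀ {P Q} → (∀ z → χ P z ≡ χ Q z) → P Sub.≈ Q
    χ-ext {P} {Q} eq z = mk⇔ (χ≡⇒∈ {P} {Q} (eq z)) (χ≡⇒∈ {Q} {P} (sym (eq z)))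

    χ-≢ : ∀ {P Q z} → z ∈ P → ¬ z ∈ Q → χ P z ≢ χ Q z
    χ-≢ {P} {Q} z∈P z∉Q eq = z∉Q (χ≡⇒∈ {P} {Q} eq z∈P)

    -- Adjacency with its direction named, phrased by `χ` so that flips compose through transitivity
    -- of equality.
    Flip : A → List A → List A → Set ℓ
    Flip i P Q = χ P i ≢ χ Q i × (∀ {z} → ¬ i ≈ z → χ P z ≡ χ Q z)

    adjacent⇒flip : ∀ {P Q} → Adjacent X P Q → ∃[ i ] Flip i P Q
    adjacent⇒flip {P} {Q} (i , i∈Δ , unique) = i , differ i∈Δ , same
      where
      differ : _∈[_Δ_] X i P Q → χ P i ≢ χ Q i
      differ (inj₁ (i∈P , i∉Q)) = χ-≢ {P} {Q} i∈P i∉Q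
      differ (inj₂ (i∈Q , i∉P)) = χ-≢ {Q} {P} i∈Q i∉P ∘ sym

      same : ∀ {z} → ¬ i ≈ z → χ P z ≡ χ Q z
      same {z} i≉z with em {P = z ∈ P} | em {P = z ∈ Q}
      ... | yes _   | yes _   = refl
      ... | no _    | no _    = refl
      ... | yes z∈P | no z∉Q  = contradiction (unique (inj₁ (z∈P , z∉Q))) i≉z
      ... | no z∉P  | yes z∈Q = contradiction (unique (inj₂ (z∈Q , z∉P))) i≉z

    flip⇒adjacent : ∀ {i P Q} → Flip i P Q → Adjacent X P Q
    flip⇒adjacent {i} {P} {Q} (differ , same) = i , i∈Δ , unique
      where
      i∈Δ : _∈[_Δ_] X i P Q
      i∈Δ with em {P = i ∈ P} | em {P = i ∈ Q}
      ... | yes i∈P | yes i∈Q = contradiction refl differ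
      ... | no i∉P  | no i∉Q  = contradiction refl differ
      ... | yes i∈P | no i∉Q  = inj₁ (i∈P , i∉Q)
      ... | no i∉P  | yes i∈Q = inj₂ (i∈Q , i∉P)

      unique : ∀ {z} → _∈[_Δ_] X z P Q → i ≈ z
      unique {z} z∈Δ with em {P = i ≈ z}
      ... | yes p = p
      unique (inj₁ (z∈P , z∉Q)) | no i≉z = contradiction (same i≉z) (χ-≢ {P} {Q} z∈P z∉Q)
      unique (inj₂ (z∈Q , z∉P)) | no i≉z = contradiction (sym (same i≉z)) (χ-≢ {Q} {P} z∈Q z∉P)

    flip-sym : ∀ {i P Q} → Flip i P Q → Flip i Q P
    flip-sym (differ , same) = differ ∘ sym , λ i≉z → sym (same i≉z)

    flip-label : ∀ {i j P Q} → i ≈ j → Flip i P Q → Flip j P Q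
    flip-label {P = P} {Q} p (differ , same) =
      (λ eq → differ (trans (χ-congʳ P p) (trans eq (χ-congʳ Q (≈-sym p))))) ,
      λ j≉z → same (λ q → j≉z (≈-trans (≈-sym p) q))

    flip-flip : ∀ {i P Q R} → Flip i P Q → Flip i Q R → P Sub.≈ R
    flip-flip {i} {P} {Q} {R} (differ , same) (differ′ , same′) = χ-ext eq
      where
      eq : ∀ z → χ P z ≡ χ R z
      eq z with em {P = i ≈ z}
      ... | yes p  = trans (χ-congʳ P (≈-sym p)) (trans (≢-≢⇒≡ differ differ′) (χ-congʳ R p))
      ... | no i≉z = trans (same i≉z) (same′ i≉z)

    -- Flips in different directions commute: `P S` is the side opposite to `Q R` in a square of the
    -- cube.
    flip-square : ∀ {i j P Q R S} → ¬ i ≈ j →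
                  Flip i P Q → Flip j Q R → Flip i R S → Flip j P S
    flip-square {i} {j} {P} {Q} {R} {S} i≉j (differ , same) (differ′ , same′) (differ″ , same″) =
      (λ eq → differ′ (trans (sym (same i≉j)) (trans eq (sym (same″ i≉j))))) , eq
      where
      eq : ∀ {z} → ¬ j ≈ z → χ P z ≡ χ S z
      eq {z} j≉z with em {P = i ≈ z}
      ... | no i≉z = trans (same i≉z) (trans (same′ j≉z) (same″ i≉z))
      -- At `i` itself the two flips cancel, as the flip of `j` between them leaves this coordinate
      -- alone.
      ... | yes p  = trans (χ-congʳ P (≈-sym p)) (trans (≢-≢⇒≡ differ Q≢S) (χ-congʳ S p))
        where
        Q≢S : χ Q i ≢ χ S i
        Q≢S eq = differ″ (trans (sym (same′ (i≉j ∘ ≈-sym))) eq)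

    insert-flip : ∀ {i P} → ¬ i ∈ P → Flip i (i ∷ P) P
    insert-flip {i} {P} i∉P =
      χ-≢ {i ∷ P} {P} (here ≈-refl) i∉P ,
      λ i≉z → does-⇔ (mk⇔ (λ { (here p) → contradiction (≈-sym p) i≉z ; (there z∈P) → z∈P })
                           there) em em

    -- A list may repeat `i`, so every occurrence is filtered out.
    remove-flip : ∀ {i P} → i ∈ P → ∃[ Q ] Flip i P Q
    remove-flip {i} {P} i∈P = filter i≉? P ,
      χ-≢ {P} {filter i≉? P} i∈P (λ i∈ → proj₂ (∈.∈-filter⁻ X i≉? resp {xs = P} i∈) ≈-refl) ,
      λ i≉z → does-⇔ (mk⇔ (λ z∈P → ∈.∈-filter⁺ X i≉? resp z∈P i≉z)
                           (λ z∈ → proj₁ (∈.∈-filter⁻ X i≉? resp {xs = P} z∈))) em em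
      where
      i≉? : ∀ z → Dec (¬ i ≈ z)
      i≉? z = ¬? em

      resp : ∀ {y z} → y ≈ z → ¬ i ≈ y → ¬ i ≈ z
      resp p i≉y q = i≉y (≈-trans q (≈-sym p))

    toggle : ∀ i P → ∃[ Q ] Flip i P Q
    toggle i P = toggle′ em
      where
      toggle′ : Dec (i ∈ P) → ∃[ Q ] Flip i P Q
      toggle′ (yes i∈P) = remove-flip i∈P
      toggle′ (no i∉P)  = i ∷ P , flip-sym {P = i ∷ P} {P} (insert-flip i∉P)

    insert-walk : ∀ x P → ∃[ n ] Walk H (x ∷ P) P n × Walk H P (x ∷ P) n
    insert-walk x P with em {P = x ∈ P}
    ... | no x∉P = 1 ,
      step (flip⇒adjacent {P = x ∷ P} {P} flip) (stop (Sub.refl {P})) ,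
      step (flip⇒adjacent {P = P} {x ∷ P} (flip-sym {P = x ∷ P} {P} flip)) (stop (Sub.refl {x ∷ P}))
      where flip = insert-flip x∉P
    ... | yes x∈P = 0 , stop absorb , stop (Sub.sym {x ∷ P} {P} absorb)
      where
      absorb : (x ∷ P) Sub.≈ P
      absorb z = mk⇔ (λ { (here p) → ∈.∈-resp-≈ X (≈-sym p) x∈P ; (there z∈P) → z∈P }) there

    connected : ∀ P Q → ∃[ n ] Walk H P Q n
    connected []      []      = 0 , stop (Sub.refl {[]})
    connected (x ∷ P) []      =
      let _ , w , _ = insert-walk x P
          _ , w′    = connected P []
      in _ , Walks.concat H w w′
    connected P       (x ∷ Q) =
      let _ , w     = connected P Q
          _ , _ , w′ = insert-walk x Q
      in _ , Walks.concat H w w′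

    -- If P lies on x's side of the direction i, a walk from y to P must cross
    -- that direction; reflecting the part before the crossing saves a step.
    closer : ∀ {i x y P n} → Flip i x y → χ x i ≡ χ P i →
             Walk H y P n → ∃[ m ] m < n × Walk H x P m
    closer {i} (differ , _) agree (stop y≈P) =
      contradiction (trans agree (sym (χ-congˡ y≈P i))) differ
    closer {i} {x} {y} {P} xy agree (step {v = y′} {n = n} e w)
      with adjacent⇒flip {y} {y′} e
    ... | k , yy′ with em {P = i ≈ k}
    ... | yes p = n , ≤-refl , Walks.walk-respˡ H (Sub.sym {x} {y′} x≈y′) w
      where
      x≈y′ : x Sub.≈ y′
      x≈y′ = flip-flip {Q = y} xy (flip-label {P = y} {y′} (≈-sym p) yy′)
    ... | no i≉k =
      let x′ , y′x′ = toggle i y′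
          xx′ = flip-square {P = x} {y} {y′} {x′} i≉k xy yy′ y′x′
          m , m<n , w′ = closer (flip-sym {P = y′} {x′} y′x′)
                                (trans (sym (proj₂ xx′ (i≉k ∘ ≈-sym))) agree) w
      in suc m , s≤s m<n , step (flip⇒adjacent {P = x} {x′} xx′) w′

  -- Comparing distances to the two ends of an edge.

  Closer : (G : Graph ℓ) (x y u : Graph.Vertex G) → Set ℓ
  Closer G x y u = ∀ {n} → Walk G y u n → ∃[ m ] m < n × Walk G x u m

  -- In a connected graph `Closer G x y u` stands for d(x,u) < d(y,u), without computing distances.
  -- Alternating both hypotheses would shorten a walk from `x` to `u` forever.
  closer-asym : ∀ (G : Graph ℓ) {x y u n} → Closer G x y u → Closer G y x u → ¬ Walk G x u n
  closer-asym G {x} {y} {u} {n} x<y y<x = descend (suc n) ≤-refl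
    where
    descend : ∀ k {m} → m < k → ¬ Walk G x u m
    descend (suc k) (s≤s m≤k) w =
      let _ , m′<m , w′  = y<x w
          _ , m″<m′ , w″ = x<y w′
      in descend k (<-≤-trans m″<m′ (≤-trans (<⇒≤ m′<m) m≤k)) w″

  module Embedded {G : Graph ℓ} (X : Setoid ℓ ℓ) (φ : IsometricEmbedding G (Hypercube X)) where
    open Graph G using (_~_)
    open Cube X
    open Isometric φ public

    connectedᴳ : ∀ u v → ∃[ n ] Walk G u v n
    connectedᴳ u v =
      let _ , w     = connected (to u) (to v)
          n , _ , w′ = reflect w
      in n , w′

    closerᴳ : ∀ {i x y u} → Flip i (to x) (to y) → χ (to x) i ≡ χ (to u) i → Closer G x y u
    closerᴳ xy agree w =
      let m , m<n , w′  = closer xy agree (preserve w)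
          k , k≤m , w″ = reflect w′
      in k , ≤-trans (s≤s k≤m) m<n , w″

    label : ∀ {u v} → u ~ v → A
    label e = proj₁ (adjacent⇒flip (edge e))

    label-flip : ∀ {u v} (e : u ~ v) → Flip (label e) (to u) (to v)
    label-flip e = proj₂ (adjacent⇒flip (edge e))

  -- Labels in two embeddings of the same graph.

  module _ {G : Graph ℓ} (X Y : Setoid ℓ ℓ)
           (φ : IsometricEmbedding G (Hypercube X)) (ψ : IsometricEmbedding G (Hypercube Y)) where
    private
      module X = Cube X
      module Y = Cube Y
      module φ = Embedded X φ
      module ψ = Embedded Y ψ

    private
      -- If `x` and `u` agreed at `i`, then `y` and `v` would too, so `x` is closer to `u` and `y`
      -- is closer to `v`. But `u` and `v` lie on the same side of `j`, so one of `x` and `y` is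
      -- closer to both. `parallel` applies this to an edge `u v` not flipping `j`, reversed if
      -- necessary.
      ¬oriented : ∀ {x y u v i j} →
        X.Flip i (φ.to x) (φ.to y) → X.Flip i (φ.to u) (φ.to v) → Y.Flip j (ψ.to x) (ψ.to y) →
        Y.χ (ψ.to u) j ≡ Y.χ (ψ.to v) j → X.χ (φ.to x) i ≢ X.χ (φ.to u) i
      ¬oriented {x} {y} {u} {v} {i} {j} xyᵢ uvᵢ xyⱼ u∥v x∥u
        with Y.χ (ψ.to x) j ≟ᵇ Y.χ (ψ.to v) j
      ... | yes eq = closer-asym G (ψ.closerᴳ xyⱼ eq) y<x∣v (proj₂ (φ.connectedᴳ x v))
        where
        y<x∣v : Closer G y x v
        y<x∣v = φ.closerᴳ (X.flip-sym {P = φ.to x} {φ.to y} xyᵢ)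
          (≢-≢⇒≡ (proj₁ xyᵢ ∘ sym) (λ eq → proj₁ uvᵢ (trans (sym x∥u) eq)))
      ... | no neq = closer-asym G x<y∣u y<x∣u (proj₂ (φ.connectedᴳ x u))
        where
        x<y∣u : Closer G x y u
        x<y∣u = φ.closerᴳ xyᵢ x∥u

        y<x∣u : Closer G y x u
        y<x∣u = ψ.closerᴳ (Y.flip-sym {P = ψ.to x} {ψ.to y} xyⱼ)
          (≢-≢⇒≡ (proj₁ xyⱼ ∘ sym) (λ eq → neq (trans eq u∥v)))

    -- Having equal labels does not depend on the embedding: it means that the
    -- two ends of one edge are closer to different ends of the other.
    parallel : ∀ {x y u v i j k} →
      X.Flip i (φ.to x) (φ.to y) → X.Flip i (φ.to u) (φ.to v) →
      Y.Flip j (ψ.to x) (ψ.to y) → Y.Flip k (ψ.to u) (ψ.to v) → j Y.≈ k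
    parallel {x} {y} {u} {v} {i} {j} {k} xyᵢ uvᵢ xyⱼ uvₖ with em {P = j Y.≈ k}
    ... | yes j≈k = j≈k
    ... | no  j≉k with X.χ (φ.to x) i ≟ᵇ X.χ (φ.to u) i | proj₂ uvₖ (j≉k ∘ Y.≈-sym)
    ...   | yes x∥u | u∥v = contradiction x∥u (¬oriented xyᵢ uvᵢ xyⱼ u∥v)
    ...   | no  x∦u | u∥v = contradiction (≢-≢⇒≡ x∦u (proj₁ uvᵢ))
      (¬oriented xyᵢ (X.flip-sym {P = φ.to u} {φ.to v} uvᵢ) xyⱼ (sym u∥v))

  -- Projecting a cube to a subset of its coordinates.

  module Preimage {A X : Setoid ℓ ℓ} (ι : A ≼ X) where
    private
      module A = Cube A
      module X = Cube X
    open Injection ι using (to; injective) renaming (cong to to-cong)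

    preimage : List X.A → List A.A
    preimage [] = []
    preimage (x ∷ P) with em {P = ∃[ a ] to a X.≈ x}
    ... | yes (a , _) = a ∷ preimage P
    ... | no _        = preimage P

    ∈-preimage : ∀ {a} P → a A.∈ preimage P ⇔ to a X.∈ P
    ∈-preimage P = mk⇔ (into P) (back P)
      where
      into : ∀ {a} P → a A.∈ preimage P → to a X.∈ P
      into (x ∷ P) a∈ with em {P = ∃[ a ] to a X.≈ x}
      into (x ∷ P) (here p)   | yes (_ , q) = here (X.≈-trans (to-cong p) q)
      into (x ∷ P) (there a∈) | yes _       = there (into P a∈)
      into (x ∷ P) a∈         | no _        = there (into P a∈)

      back : ∀ {a} P → to a X.∈ P → a A.∈ preimage P
      back (x ∷ P) a∈ with em {P = ∃[ a ] to a X.≈ x}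
      back (x ∷ P) (here p)   | yes (_ , q) = here (injective (X.≈-trans p (X.≈-sym q)))
      back (x ∷ P) (there a∈) | yes _       = there (back P a∈)
      back (x ∷ P) (here p)   | no ∉        = contradiction (_ , p) ∉
      back (x ∷ P) (there a∈) | no _        = back P a∈

    χ-preimage : ∀ P a → A.χ (preimage P) a ≡ X.χ P (to a)
    χ-preimage P a = does-⇔ (∈-preimage P) em em

    preimage-cong : ∀ {P Q} → P X.Sub.≈ Q → preimage P A.Sub.≈ preimage Q
    preimage-cong {P} {Q} P≈Q = A.χ-ext λ a →
      trans (χ-preimage P a) (trans (X.χ-congˡ P≈Q (to a)) (sym (χ-preimage Q a)))

    flip-preimage : ∀ {a P Q} → X.Flip (to a) P Q → A.Flip a (preimage P) (preimage Q)
    flip-preimage {a} {P} {Q} (differ , same) =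
      (λ eq → differ (trans (sym (χ-preimage P a)) (trans eq (χ-preimage Q a)))) ,
      λ {b} a≉b →
        trans (χ-preimage P b) (trans (same (a≉b ∘ injective)) (sym (χ-preimage Q b)))

    preimage-const : ∀ {i P Q} → (∀ a → ¬ i X.≈ to a) → X.Flip i P Q →
                     preimage P A.Sub.≈ preimage Q
    preimage-const {i} {P} {Q} ∉ (_ , same) = A.χ-ext λ a →
      trans (χ-preimage P a) (trans (same (∉ a)) (sym (χ-preimage Q a)))

    -- Every step is repeated from `P` in the corresponding direction, so the length is kept and
    -- coordinates outside the image of `ι` never change.
    walk-lift : ∀ {B C n} P → (∀ a → A.χ B a ≡ X.χ P (to a)) → Walk A.H B C n →
                ∃[ Q ] Walk X.H P Q n × (∀ a → A.χ C a ≡ X.χ Q (to a)) ×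
                       (∀ {z} → (∀ a → ¬ to a X.≈ z) → X.χ P z ≡ X.χ Q z)
    walk-lift P P∣B (stop B≈C) =
      P , stop (X.Sub.refl {P}) , (λ a → trans (sym (A.χ-congˡ B≈C a)) (P∣B a)) , λ _ → refl
    walk-lift {B} P P∣B (step {v = B′} e w) =
      let b , BB′ = A.adjacent⇒flip {B} {B′} e
          P′ , PP′ = X.toggle (to b) P
          Q , w′ , Q∣C , same = walk-lift P′ (agree BB′ PP′) w
      in Q , step (X.flip⇒adjacent {P = P} {P′} PP′) w′ , Q∣C ,
         λ ∉ → trans (proj₂ PP′ (∉ b)) (same ∉)
      where
      agree : ∀ {b P′} → A.Flip b B B′ → X.Flip (to b) P P′ → ∀ a → A.χ B′ a ≡ X.χ P′ (to a)
      agree {b} {P′} BB′ PP′ a with em {P = b A.≈ a}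
      ... | no b≉a  = trans (sym (proj₂ BB′ b≉a)) (trans (P∣B a) (proj₂ PP′ (b≉a ∘ injective)))
      -- At the flipped coordinate both sets leave the same value, and only one other value remains.
      ... | yes b≈a = ≢-≢⇒≡ (proj₁ (A.flip-label {P = B} {B′} b≈a BB′) ∘ sym)
        (λ eq → proj₁ (X.flip-label {P = P} {P′} (to-cong b≈a) PP′) (trans (sym (P∣B a)) eq))

  -- The set of labels as the isometric dimension.

  module EdgeLabels {G : Graph ℓ} (X : Setoid ℓ ℓ)
                    (φ : IsometricEmbedding G (Hypercube X)) where
    open Graph G using (_~_; Vertex)
    open Embedded X φ
    private
      module X = Cube X

    Edge : Set ℓ
    Edge = Σ Vertex λ u → Σ Vertex λ v → u ~ v

    labelOf : Edge → X.A
    labelOf (_ , _ , e) = label e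

    -- Labels are represented by edges rather than by elements of `X`: a map out of `labels` then
    -- needs no choice of an edge for each label. The classes are those of the Djoković-Winkler
    -- relation.
    labels : Setoid ℓ ℓ
    labels = record
      { Carrier       = Edge
      ; _≈_           = λ e f → labelOf e X.≈ labelOf f
      ; isEquivalence = record { refl = X.≈-refl ; sym = X.≈-sym ; trans = X.≈-trans }
      }

    labels≼X : labels ≼ X
    labels≼X = record { to = labelOf ; cong = λ p → p ; injective = λ p → p }

    open Preimage labels≼X

    -- Each step changes only its own label.
    χ-unused : ∀ {z u v n} → (∀ e → ¬ labelOf e X.≈ z) → Walk G u v n →
               X.χ (to u) z ≡ X.χ (to v) z
    χ-unused ∉ (stop p)   = X.χ-congˡ (to-cong p) _
    χ-unused ∉ (step e w) = trans (proj₂ (label-flip e) (∉ (_ , _ , e))) (χ-unused ∉ w)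

    restricted : IsometricEmbedding G (Hypercube labels)
    restricted = isometricEmbedding G (Hypercube labels)
      (record { to = λ v → preimage (to v) ; cong = λ p → preimage-cong (to-cong p) })
      (λ {u} {v} e → Cube.flip⇒adjacent labels {P = preimage (to u)} {preimage (to v)}
                       (flip-preimage {(_ , _ , e)} {to u} {to v} (label-flip e)))
      reflect′
      where
      reflect′ : ∀ {u v n} → Walk (Hypercube labels) (preimage (to u)) (preimage (to v)) n →
                 ∃[ m ] m ≤ n × Walk G u v m
      reflect′ {u} {v} w =
        let Q , w′ , Q∣v , same = walk-lift (to u) (χ-preimage (to u)) w
        in reflect (Walks.walk-respʳ X.H (X.χ-ext (eq Q Q∣v same)) w′)
        where
        eq : ∀ Q → (∀ e → Cube.χ labels (preimage (to v)) e ≡ X.χ Q (labelOf e)) →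
             (∀ {z} → (∀ e → ¬ labelOf e X.≈ z) → X.χ (to u) z ≡ X.χ Q z) →
             ∀ z → X.χ Q z ≡ X.χ (to v) z
        eq Q Q∣v same z with em {P = ∃[ e ] labelOf e X.≈ z}
        ... | yes (e , p) = trans (X.χ-congʳ Q (X.≈-sym p)) (trans (sym (Q∣v e))
                              (trans (χ-preimage (to v) e) (X.χ-congʳ (to v) p)))
        ... | no unused   = trans (sym (same ∉)) (χ-unused ∉ (proj₂ (connectedᴳ u v)))
          where
          ∉ : ∀ e → ¬ labelOf e X.≈ z
          ∉ e p = unused (e , p)

  -- An edge is sent to its label under `ψ`. This is well defined by `parallel` from `φ` to `ψ`, and
  -- injective by `parallel` from `ψ` to `φ`.
  isometricDimension : {G : Graph ℓ} → IsPartialCube G → IsometricDimension G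
  isometricDimension {G} (X , φ) = record
    { cardinal = labels
    ; attained = restricted
    ; minimum  = λ Y ψ →
        let open Embedded Y ψ renaming (label to labelʸ; label-flip to labelʸ-flip) in record
        { to        = λ (_ , _ , e) → labelʸ e
        ; cong      = λ {(_ , _ , e)} {(x , y , f)} p →
            parallel X Y φ ψ (label-flip e)
              (X.flip-label {P = φ.to x} {φ.to y} (X.≈-sym p) (label-flip f))
              (labelʸ-flip e) (labelʸ-flip f)
        ; injective = λ {(_ , _ , e)} {(x , y , f)} p →
            parallel Y X ψ φ (labelʸ-flip e)
              (Cube.flip-label Y {P = Isometric.to ψ x} {Isometric.to ψ y}
                (Setoid.sym Y p) (labelʸ-flip f))
              (label-flip e) (label-flip f)
        }
    }
    where
    open EdgeLabels X φ
    open Embedded X φ using (label; label-flip)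
    module φ = Isometric φ
    module X = Cube X

  -- The cube on a disjoint union as a product of cubes.

  module Join (X₁ X₂ : Setoid ℓ ℓ) where
    private
      module X₁ = Cube X₁
      module X₂ = Cube X₂
      module X  = Cube (X₁ ⊎ₛ X₂)

      ι₁ : X₁ ≼ (X₁ ⊎ₛ X₂)
      ι₁ = record { to = inj₁ ; cong = inj₁ ; injective = drop-inj₁ }

      ι₂ : X₂ ≼ (X₁ ⊎ₛ X₂)
      ι₂ = record { to = inj₂ ; cong = inj₂ ; injective = drop-inj₂ }

      module ι₁ = Preimage ι₁
      module ι₂ = Preimage ι₂

    join : List X₁.A → List X₂.A → List X.A
    join P Q = map inj₁ P ++ map inj₂ Q

    χ-join₁ : ∀ P Q z → X.χ (join P Q) (inj₁ z) ≡ X₁.χ P z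
    χ-join₁ P Q z = does-⇔ (mk⇔ (into P) back) em em
      where
      right : ∀ Q → ¬ inj₁ z X.∈ map inj₂ Q
      right (_ ∷ Q) (there z∈) = right Q z∈

      into : ∀ P → inj₁ z X.∈ join P Q → z X₁.∈ P
      into []      z∈              = contradiction z∈ (right Q)
      into (_ ∷ P) (here (inj₁ p)) = here p
      into (_ ∷ P) (there z∈)      = there (into P z∈)

      back : z X₁.∈ P → inj₁ z X.∈ join P Q
      back z∈ = ∈.∈-++⁺ˡ (X₁ ⊎ₛ X₂) (∈.∈-map⁺ X₁ (X₁ ⊎ₛ X₂) inj₁ z∈)

    χ-join₂ : ∀ P Q z → X.χ (join P Q) (inj₂ z) ≡ X₂.χ Q z
    χ-join₂ P Q z = does-⇔ (mk⇔ (into P) back) em em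
      where
      right : ∀ Q → inj₂ z X.∈ map inj₂ Q → z X₂.∈ Q
      right (_ ∷ Q) (here (inj₂ p)) = here p
      right (_ ∷ Q) (there z∈)      = there (right Q z∈)

      into : ∀ P → inj₂ z X.∈ join P Q → z X₂.∈ Q
      into []      z∈         = right Q z∈
      into (_ ∷ P) (there z∈) = into P z∈

      back : z X₂.∈ Q → inj₂ z X.∈ join P Q
      back z∈ = ∈.∈-++⁺ʳ (X₁ ⊎ₛ X₂) (map inj₁ P) (∈.∈-map⁺ X₂ (X₁ ⊎ₛ X₂) inj₂ z∈)

    join-cong : ∀ {P P′ Q Q′} → P X₁.Sub.≈ P′ → Q X₂.Sub.≈ Q′ → join P Q X.Sub.≈ join P′ Q′
    join-cong {P} {P′} {Q} {Q′} p q = X.χ-ext λ where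
      (inj₁ z) → trans (χ-join₁ P Q z) (trans (X₁.χ-congˡ p z) (sym (χ-join₁ P′ Q′ z)))
      (inj₂ z) → trans (χ-join₂ P Q z) (trans (X₂.χ-congˡ q z) (sym (χ-join₂ P′ Q′ z)))

    flip-join₁ : ∀ {i P P′} Q → X₁.Flip i P P′ → X.Flip (inj₁ i) (join P Q) (join P′ Q)
    flip-join₁ {i} {P} {P′} Q (differ , same) =
      (λ eq → differ (trans (sym (χ-join₁ P Q i)) (trans eq (χ-join₁ P′ Q i)))) , eq
      where
      eq : ∀ {z} → ¬ inj₁ i X.≈ z → X.χ (join P Q) z ≡ X.χ (join P′ Q) z
      eq {inj₁ z} i≉z = trans (χ-join₁ P Q z)
                         (trans (same (λ p → i≉z (inj₁ p))) (sym (χ-join₁ P′ Q z)))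
      eq {inj₂ z} _   = trans (χ-join₂ P Q z) (sym (χ-join₂ P′ Q z))

    flip-join₂ : ∀ {i} P {Q Q′} → X₂.Flip i Q Q′ → X.Flip (inj₂ i) (join P Q) (join P Q′)
    flip-join₂ {i} P {Q} {Q′} (differ , same) =
      (λ eq → differ (trans (sym (χ-join₂ P Q i)) (trans eq (χ-join₂ P Q′ i)))) , eq
      where
      eq : ∀ {z} → ¬ inj₂ i X.≈ z → X.χ (join P Q) z ≡ X.χ (join P Q′) z
      eq {inj₁ z} _   = trans (χ-join₁ P Q z) (sym (χ-join₁ P Q′ z))
      eq {inj₂ z} i≉z = trans (χ-join₂ P Q z)
                         (trans (same (λ p → i≉z (inj₂ p))) (sym (χ-join₂ P Q′ z)))

    private
      -- Each step flips a coordinate of one summand: it is a step of that projection and leaves the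
      -- other unchanged.
      split : ∀ {P Q n} → Walk X.H P Q n → ∃[ n₁ ] ∃[ n₂ ] n₁ + n₂ ≡ n ×
              Walk X₁.H (ι₁.preimage P) (ι₁.preimage Q) n₁ ×
              Walk X₂.H (ι₂.preimage P) (ι₂.preimage Q) n₂
      split (stop p) = 0 , 0 , refl , stop (ι₁.preimage-cong p) , stop (ι₂.preimage-cong p)
      split {P} (step {v = P′} e w) with X.adjacent⇒flip {P} {P′} e | split w
      ... | inj₁ i , PP′ | n₁ , n₂ , refl , w₁ , w₂ =
        suc n₁ , n₂ , refl ,
        step (X₁.flip⇒adjacent {P = ι₁.preimage P} {ι₁.preimage P′}
               (ι₁.flip-preimage {P = P} {P′} PP′)) w₁ ,
        Walks.walk-respˡ X₂.H (X₂.Sub.sym {ι₂.preimage P} {ι₂.preimage P′}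
          (ι₂.preimage-const {P = P} {P′} (λ _ ()) PP′)) w₂
      ... | inj₂ i , PP′ | n₁ , n₂ , refl , w₁ , w₂ =
        n₁ , suc n₂ , +-suc n₁ n₂ ,
        Walks.walk-respˡ X₁.H (X₁.Sub.sym {ι₁.preimage P} {ι₁.preimage P′}
          (ι₁.preimage-const {P = P} {P′} (λ _ ()) PP′)) w₁ ,
        step (X₂.flip⇒adjacent {P = ι₂.preimage P} {ι₂.preimage P′}
               (ι₂.flip-preimage {P = P} {P′} PP′)) w₂

      preimage₁-join : ∀ P Q → ι₁.preimage (join P Q) X₁.Sub.≈ P
      preimage₁-join P Q = X₁.χ-ext λ z →
        trans (ι₁.χ-preimage (join P Q) z) (χ-join₁ P Q z)

      preimage₂-join : ∀ P Q → ι₂.preimage (join P Q) X₂.Sub.≈ Q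
      preimage₂-join P Q = X₂.χ-ext λ z →
        trans (ι₂.χ-preimage (join P Q) z) (χ-join₂ P Q z)

    walk-split : ∀ P Q P′ Q′ {n} → Walk X.H (join P Q) (join P′ Q′) n →
                 ∃[ n₁ ] ∃[ n₂ ] n₁ + n₂ ≡ n × Walk X₁.H P P′ n₁ × Walk X₂.H Q Q′ n₂
    walk-split P Q P′ Q′ w =
      let n₁ , n₂ , eq , w₁ , w₂ = split w
      in n₁ , n₂ , eq ,
         Walks.walk-respˡ X₁.H (preimage₁-join P Q)
           (Walks.walk-respʳ X₁.H (preimage₁-join P′ Q′) w₁) ,
         Walks.walk-respˡ X₂.H (preimage₂-join P Q)
           (Walks.walk-respʳ X₂.H (preimage₂-join P′ Q′) w₂)

  -- Vertex-pasting: its retractions and its embedding.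

  module Pasting (G₁ G₂ : Graph ℓ) (a₁ : Graph.Vertex G₁) (a₂ : Graph.Vertex G₂) where
    private
      module G₁ = Graph G₁
      module G₂ = Graph G₂
      module V₁ = Setoid G₁.vertices
      module V₂ = Setoid G₂.vertices

      G : Graph ℓ
      G = VertexPasting G₁ G₂ a₁ a₂

      module G = Graph G
      module V = Setoid G.vertices

    ι₁ : Func G₁.vertices G.vertices
    ι₁ = record { to = inj₁ ; cong = same₁ }

    ι₂ : Func G₂.vertices G.vertices
    ι₂ = record { to = inj₂ ; cong = same₂ }

    ι₁-edge : ∀ {u v} → u G₁.~ v → inj₁ u G.~ inj₁ v
    ι₁-edge e = _ , _ , V.refl , V.refl , inj₁ e

    ι₂-edge : ∀ {u v} → u G₂.~ v → inj₂ u G.~ inj₂ v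
    ι₂-edge e = _ , _ , V.refl , V.refl , inj₂ e

    π₁ : Func G.vertices G₁.vertices
    π₁ = record
      { to   = λ { (inj₁ x) → x ; (inj₂ _) → a₁ }
      ; cong = λ { (same₁ p) → p ; (same₂ _) → V₁.refl
                 ; (glue₁₂ p _) → p ; (glue₂₁ _ p) → V₁.sym p }
      }

    π₂ : Func G.vertices G₂.vertices
    π₂ = record
      { to   = λ { (inj₁ _) → a₂ ; (inj₂ y) → y }
      ; cong = λ { (same₁ _) → V₂.refl ; (same₂ p) → p
                 ; (glue₁₂ _ p) → V₂.sym p ; (glue₂₁ p _) → p }
      }

    open Func π₁ public using () renaming (to to p₁; cong to p₁-cong)
    open Func π₂ public using () renaming (to to p₂; cong to p₂-cong)

    π₁-edge : ∀ {u v} → u G.~ v → p₁ u G₁.~ p₁ v ⊎ p₁ u G₁.≈ p₁ v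
    π₁-edge (_ , _ , p , q , inj₁ e) =
      inj₁ (proj₂ G₁.~-resp-≈ (V₁.sym (p₁-cong p)) (proj₁ G₁.~-resp-≈ (V₁.sym (p₁-cong q)) e))
    π₁-edge (_ , _ , p , q , inj₂ e) = inj₂ (V₁.trans (p₁-cong p) (V₁.sym (p₁-cong q)))

    π₂-edge : ∀ {u v} → u G.~ v → p₂ u G₂.~ p₂ v ⊎ p₂ u G₂.≈ p₂ v
    π₂-edge (_ , _ , p , q , inj₁ e) = inj₂ (V₂.trans (p₂-cong p) (V₂.sym (p₂-cong q)))
    π₂-edge (_ , _ , p , q , inj₂ e) =
      inj₁ (proj₂ G₂.~-resp-≈ (V₂.sym (p₂-cong p)) (proj₁ G₂.~-resp-≈ (V₂.sym (p₂-cong q)) e))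

    -- The retraction `π₁`, collapsing the other part to `a₁`, brings walks of the pasting back
    -- without lengthening them.
    isometric₁ : IsometricEmbedding G₁ G
    isometric₁ = isometricEmbedding G₁ G ι₁ ι₁-edge (walk-contract G G₁ π₁ π₁-edge)

    isometric₂ : IsometricEmbedding G₂ G
    isometric₂ = isometricEmbedding G₂ G ι₂ ι₂-edge (walk-contract G G₂ π₂ π₂-edge)

    -- With ends in different parts, the two walks meet at the glued vertex. With both ends in one
    -- part, the other walk is closed at the glued vertex and is discarded.
    glue-walks : ∀ u v {n₁ n₂} → Walk G₁ (p₁ u) (p₁ v) n₁ → Walk G₂ (p₂ u) (p₂ v) n₂ →
                 ∃[ m ] m ≤ n₁ + n₂ × Walk G u v m
    glue-walks (inj₁ x) (inj₁ y) {n₁} {n₂} w₁ w₂ =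
      n₁ , m≤m+n n₁ n₂ , walk-map G₁ G ι₁ ι₁-edge w₁
    glue-walks (inj₂ x) (inj₂ y) {n₁} {n₂} w₁ w₂ =
      n₂ , m≤n+m n₂ n₁ , walk-map G₂ G ι₂ ι₂-edge w₂
    glue-walks (inj₁ x) (inj₂ y) {n₁} {n₂} w₁ w₂ =
      n₁ + n₂ , ≤-refl , Walks.concat G (walk-map G₁ G ι₁ ι₁-edge w₁)
        (Walks.walk-respˡ G (glue₂₁ V₂.refl V₁.refl) (walk-map G₂ G ι₂ ι₂-edge w₂))
    glue-walks (inj₂ x) (inj₁ y) {n₁} {n₂} w₁ w₂ =
      n₂ + n₁ , ≤-reflexive (+-comm n₂ n₁) , Walks.concat G (walk-map G₂ G ι₂ ι₂-edge w₂)
        (Walks.walk-respˡ G (glue₁₂ V₁.refl V₂.refl) (walk-map G₁ G ι₁ ι₁-edge w₁))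

    module _ (X₁ X₂ : Setoid ℓ ℓ) (φ₁ : IsometricEmbedding G₁ (Hypercube X₁))
             (φ₂ : IsometricEmbedding G₂ (Hypercube X₂)) where
      private
        module φ₁ = Embedded X₁ φ₁
        module φ₂ = Embedded X₂ φ₂
        module X₁ = Cube X₁
        module X₂ = Cube X₂
        module X  = Cube (X₁ ⊎ₛ X₂)
      open Join X₁ X₂

      -- On each part the component of the other is constant, the image of the glued vertex; hence
      -- the edges of each part are labelled in their own summand.
      θ : Func G.vertices (FiniteSubset (X₁ ⊎ₛ X₂))
      θ = record
        { to   = λ u → join (φ₁.to (p₁ u)) (φ₂.to (p₂ u))
        ; cong = λ {u} {v} p → join-cong {φ₁.to (p₁ u)} {φ₁.to (p₁ v)}
                     {φ₂.to (p₂ u)} {φ₂.to (p₂ v)}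
                   (φ₁.to-cong (p₁-cong p)) (φ₂.to-cong (p₂-cong p))
        }

      open Func θ using () renaming (to to t; cong to t-cong)

      θ-flip₁ : ∀ {x y} (e : x G₁.~ y) → X.Flip (inj₁ (φ₁.label e)) (t (inj₁ x)) (t (inj₁ y))
      θ-flip₁ e = flip-join₁ (φ₂.to a₂) (φ₁.label-flip e)

      θ-flip₂ : ∀ {x y} (e : x G₂.~ y) → X.Flip (inj₂ (φ₂.label e)) (t (inj₂ x)) (t (inj₂ y))
      θ-flip₂ e = flip-join₂ (φ₁.to a₁) (φ₂.label-flip e)

      private
        θ-edge : ∀ {u v} → u G.~ v → Graph._~_ X.H (t u) (t v)
        θ-edge {u} {v} (u′ , v′ , p , q , e) =
          proj₂ (Graph.~-resp-≈ X.H) {t v} {t u′} {t u} (X.Sub.sym {t u} {t u′} (t-cong p))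
            (proj₁ (Graph.~-resp-≈ X.H) {t u′} {t v′} {t v} (X.Sub.sym {t v} {t v′} (t-cong q))
              (adj e))
          where
          adj : ∀ {u v} → Pointwise G₁._~_ G₂._~_ u v → Graph._~_ X.H (t u) (t v)
          adj (inj₁ {x} {y} e) = X.flip⇒adjacent {P = t (inj₁ x)} {t (inj₁ y)} (θ-flip₁ e)
          adj (inj₂ {x} {y} e) = X.flip⇒adjacent {P = t (inj₂ x)} {t (inj₂ y)} (θ-flip₂ e)

        θ-reflect : ∀ {u v n} → Walk X.H (t u) (t v) n → ∃[ m ] m ≤ n × Walk G u v m
        θ-reflect {u} {v} w
          with walk-split (φ₁.to (p₁ u)) (φ₂.to (p₂ u)) (φ₁.to (p₁ v)) (φ₂.to (p₂ v)) w
        ... | n₁ , n₂ , refl , w₁ , w₂ =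
          let m₁ , m₁≤n₁ , w₁′ = φ₁.reflect w₁
              m₂ , m₂≤n₂ , w₂′ = φ₂.reflect w₂
              m , m≤ , w′ = glue-walks u v w₁′ w₂′
          in m , ≤-trans m≤ (+-mono-≤ m₁≤n₁ m₂≤n₂) , w′

      pasted : IsometricEmbedding G (Hypercube (X₁ ⊎ₛ X₂))
      pasted = isometricEmbedding G (Hypercube (X₁ ⊎ₛ X₂)) θ θ-edge θ-reflect

    -- Labels of the two parts in an embedding of the pasting.

    module _ (X₁ X₂ X : Setoid ℓ ℓ)
             (φ₁ : IsometricEmbedding G₁ (Hypercube X₁)) (φ₂ : IsometricEmbedding G₂ (Hypercube X₂))
             (φ : IsometricEmbedding G (Hypercube X)) where
      private
        ψ₁ = composeIsometric isometric₁ φ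
        ψ₂ = composeIsometric isometric₂ φ
        module φ  = Isometric φ
        module X  = Cube X
        module ψ₁ = Embedded X ψ₁
        module ψ₂ = Embedded X ψ₂

        -- By `parallel`, a common label in `X` would also be one in `pasted`, where the two labels
        -- lie in different summands.
        disjoint : ∀ {u v x y} (e : u G₁.~ v) (f : x G₂.~ y) → ¬ ψ₁.label e X.≈ ψ₂.label f
        disjoint {u} {v} {x} {y} e f p
          with parallel X (X₁ ⊎ₛ X₂) φ (pasted X₁ X₂ φ₁ φ₂)
                 {inj₁ u} {inj₁ v} {inj₂ x} {inj₂ y}
                 (ψ₁.label-flip e)
                 (X.flip-label {P = φ.to (inj₂ x)} {φ.to (inj₂ y)} (X.≈-sym p) (ψ₂.label-flip f))
                 (θ-flip₁ X₁ X₂ φ₁ φ₂ e) (θ-flip₂ X₁ X₂ φ₁ φ₂ f)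
        ... | ()

      labels⊎labels≼ : (EdgeLabels.labels X ψ₁ ⊎ₛ EdgeLabels.labels X ψ₂) ≼ X
      labels⊎labels≼ = record
        { to        = [ EdgeLabels.labelOf X ψ₁ , EdgeLabels.labelOf X ψ₂ ]′
        ; cong      = λ { (inj₁ p) → p ; (inj₂ p) → p }
        ; injective = λ
            { {inj₁ _}           {inj₁ _}           p → inj₁ p
            ; {inj₂ _}           {inj₂ _}           p → inj₂ p
            ; {inj₁ (_ , _ , e)} {inj₂ (_ , _ , f)} p → contradiction p (disjoint e f)
            ; {inj₂ (_ , _ , f)} {inj₁ (_ , _ , e)} p → contradiction (X.≈-sym p) (disjoint e f)
            }
        }

    module _ (d₁ : IsometricDimension G₁) (d₂ : IsometricDimension G₂)
             (d : IsometricDimension G) where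
      private
        module d₁ = IsometricDimension d₁
        module d₂ = IsometricDimension d₂
        module d  = IsometricDimension d
        module E₁ = EdgeLabels d.cardinal (composeIsometric isometric₁ d.attained)
        module E₂ = EdgeLabels d.cardinal (composeIsometric isometric₂ d.attained)

      dimension-sum : cardinal d ≃ (cardinal d₁ ⊎ₛ cardinal d₂)
      dimension-sum = ≼-antisym
        (d.minimum _ (pasted _ _ d₁.attained d₂.attained))
        -- Each `dᵢ` is at most the set of labels its part uses in `d.attained`, as the part embeds
        -- in the cube on those labels.
        (Compose.injection
          (d₁.minimum E₁.labels E₁.restricted ⊎-injection d₂.minimum E₂.labels E₂.restricted)
          (labels⊎labels≼ _ _ _ d₁.attained d₂.attained d.attained))

-- Existence of the three dimensions is part of the conclusion, so that the equation for all their
-- representatives does not hold vacuously.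
theorem7p2 : ∀ {ℓ : Level} → ExcludedMiddle ℓ →
    (G₁ G₂ : Graph ℓ) (a₁ : Graph.Vertex G₁) (a₂ : Graph.Vertex G₂) →
    IsPartialCube G₁ → IsPartialCube G₂ →
    IsPartialCube (VertexPasting G₁ G₂ a₁ a₂) →
    IsometricDimension G₁ × IsometricDimension G₂ ×
    IsometricDimension (VertexPasting G₁ G₂ a₁ a₂) ×
    ((d₁ : IsometricDimension G₁) (d₂ : IsometricDimension G₂)
    (d : IsometricDimension (VertexPasting G₁ G₂ a₁ a₂)) →
    cardinal d ≃ (cardinal d₁ ⊎ₛ cardinal d₂))
theorem7p2 em G₁ G₂ a₁ a₂ pc₁ pc₂ pc =
  isometricDimension pc₁ , isometricDimension pc₂ , isometricDimension pc , dimension-sum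
  where
  open Classical em
  open Pasting G₁ G₂ a₁ a₂
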